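{- Let $G$ be a $2$-connected graph such that $\sigma_2(G) \ge 2\tilde{\alpha}(G) - 1$. Then $G$ is Hamiltonian.
   Context: All graphs are finite and simple. For a graph $G$, $\sigma_2(G) = \min\{d(x)+d(y) : x,y \text{ distinct, nonadjacent vertices of } G\}$, where $d$ denotes degree. For positive integers $s,t$, an $(s,t)$-bipartite-hole of $G$ is a pair of disjoint vertex sets $S,T$ with $|S|=s$, $|T|=t$ and no edge of $G$ between $S$ and $T$. The bipartite-hole-number $\tilde{\alpha}(G)$ is the minimum integer $k$ such that there exist positive integers $s,t$ with $s+t=k+1$ for which $G$ contains no $(s,t)$-bipartite-hole. A graph is Hamiltonian if it contains a cycle through all of its vertices. -}

module Defs where

open import Data.Nat using (ℕ; zero; suc; _+_; _*_; _∸_; _≤_; _<_)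
open import Data.Fin using (Fin)
open import Data.Fin.Subset using (Subset; _∈_; ∣_∣)
open import Data.Bool using (Bool; true; false; if_then_else_)
open import Data.List using (List; []; _∷_; length; map; allFin)
open import Data.Nat.ListAction using (sum)
open import Data.List.Relation.Unary.Unique.Propositional using (Unique)
import Data.List.Membership.Propositional as LM
open import Data.Product using (Σ; _×_; ∃; ∃-syntax)
open import Data.Empty using (⊥)
open import Data.Unit using (⊤)
open import Relation.Nullary using (¬_)
open import Relation.Binary.PropositionalEquality using (_≡_; _≢_)

record Graph (n : ℕ) : Set where
  field
    adj    : Fin n → Fin n → Bool
    sym    : ∀ x y → adj x y ≡ adj y x
    irrefl : ∀ x → adj x x ≡ false
open Graph public

module _ {n : ℕ} (G : Graph n) where

  degree : Fin n → ℕ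
  degree v = sum (map (λ u → if adj G v u then 1 else 0) (allFin n))

  data Reach (ok : Fin n → Set) : Fin n → Fin n → Set where
    here : ∀ {x} → ok x → Reach ok x x
    step : ∀ {x y z} → ok x → adj G x y ≡ true → Reach ok y z → Reach ok x z

  Connected : Set
  Connected = ∀ x y → Reach (λ _ → ⊤) x y

  TwoConnected : Set
  TwoConnected = (3 ≤ n) × Connected ×
    (∀ v x y → x ≢ v → y ≢ v → Reach (λ u → u ≢ v) x y)

  HasBipartiteHole : ℕ → ℕ → Set
  HasBipartiteHole s t = Σ (Subset n) λ S → Σ (Subset n) λ T →
    (∀ x → x ∈ S → x ∈ T → ⊥) × ∣ S ∣ ≡ s × ∣ T ∣ ≡ t ×
    (∀ x y → x ∈ S → y ∈ T → adj G x y ≡ false)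

  NoHoleAt : ℕ → Set
  NoHoleAt k = ∃[ s ] ∃[ t ] (1 ≤ s × 1 ≤ t × s + t ≡ suc k × ¬ HasBipartiteHole s t)

  IsBipartiteHoleNumber : ℕ → Set
  IsBipartiteHoleNumber k = NoHoleAt k × (∀ j → j < k → ¬ NoHoleAt j)

  -- σ₂(G) ≥ m, with min over the empty set = ∞ (complete graphs satisfy it)
  σ₂≥ : ℕ → Set
  σ₂≥ m = ∀ x y → x ≢ y → adj G x y ≡ false → m ≤ degree x + degree y

  Closes : Fin n → Fin n → List (Fin n) → Set
  Closes v0 x []       = adj G x v0 ≡ true
  Closes v0 x (y ∷ ys) = (adj G x y ≡ true) × Closes v0 y ys

  Hamiltonian : Set
  Hamiltonian = ∃[ v0 ] ∃[ vs ]
    (Unique (v0 ∷ vs) × (∀ v → v LM.∈ (v0 ∷ vs)) × 2 ≤ length vs × Closes v0 v0 vs)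

{-# OPTIONS --safe #-}

-- Write s + t = k + 1 for sizes s, t without an (s,t)-hole, and call a vertex high if its degree
-- is at least k.  By the degree-sum condition the vertices that are not high form a clique.
-- Make the high vertices a clique too, by adding edges: two disjoint crossing edges, which exist
-- by 2-connectedness, join the two cliques into a Hamiltonian cycle.  The added edges are then
-- removed one at a time, as in the Bondy–Chvátal closure.  When xy is removed, a Hamiltonian path
-- x ⋯ y with x and y high remains.  Cut it just before the s-th neighbour of x.  If y has at least
-- t neighbours in the second part, compare the predecessors of the first s neighbours of x with
-- the successors of the neighbours of y in the second part; otherwise y has at least s neighbours
-- in the first part, and compare their predecessors with those of the remaining neighbours of x.
-- As there is no (s,t)-hole, an edge joins the two sets, and it closes a new cycle.
-- Every chord used lies in G itself, so the hole condition is only ever needed for G.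

module Submission where

open import Defs
open import Data.Bool using (Bool; true; false; if_then_else_)
import Data.Bool.Properties as Bool
open import Data.Fin using (Fin; zero; suc)
open import Data.Fin.Properties using (_≟_; any?)
import Data.Fin.Subset as Subset
open import Data.Fin.Subset using (Subset; ∣_∣; inside; outside)
open import Data.Fin.Subset.Properties using (∣⊥∣≡0; ∉⊥)
open import Data.List using (List; []; _∷_; [_]; _++_; length; map; allFin; take; filter; cartesianProduct)
open import Data.List.Membership.Propositional using (_∈_; _∉_; find; lose)
open import Data.List.Membership.Propositional.Properties
  using (∈-++⁺ˡ; ∈-∃++; ∈-allFin; ∈-filter⁺; ∈-cartesianProduct⁺)
open import Data.List.Properties
  using (length-take; map-++; take++drop≡id; partition-defn; length-tabulate)
open import Data.List.Relation.Binary.Disjoint.Propositional using (Disjoint)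
open import Data.List.Relation.Binary.Permutation.Propositional
  using (_↭_; ↭-refl; ↭-sym; ↭-trans; prep; ↭⇒↭ₛ; ↭ₛ⇒↭)
open import Data.List.Relation.Binary.Permutation.Propositional.Properties
  using (∈-resp-↭; All-resp-↭; ↭-length; map⁺; ++⁺; ++⁺ˡ; shift; ++-comm; ++-assoc; ∷↭∷ʳ)
import Data.List.Relation.Binary.Permutation.Setoid.Properties as PermSetoid
open import Data.List.Relation.Unary.All as All using (All; []; _∷_)
import Data.List.Relation.Unary.All.Properties as All
open import Data.List.Relation.Unary.Any as Any using (here; there)
open import Data.List.Relation.Unary.AllPairs using ([]; _∷_)
open import Data.List.Relation.Unary.Unique.Propositional using (Unique)
open import Data.List.Relation.Unary.Unique.Propositional.Properties
  using (take⁺; allFin⁺; filter⁺; Unique[x∷xs]⇒x∉xs)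
open import Data.Nat using (ℕ; zero; suc; _+_; _*_; _∸_; _≤_; _<_; s≤s; s≤s⁻¹; _≤?_)
open import Data.Nat.ListAction using (sum)
open import Data.Nat.ListAction.Properties using (sum-++; sum-↭)
open import Data.Nat.Properties
  using (≤-trans; ≤-reflexive; ≤⇒≯; <⇒≱; ≰⇒>; m≤n+m; m≤n⇒m⊓n≡m; suc-injective;
         +-comm; +-suc; +-identityʳ; +-mono-≤; +-monoˡ-≤; +-monoʳ-≤; +-cancelˡ-≤)
open import Data.Product using (_×_; _,_; ∃; ∃₂; proj₁; proj₂)
open import Data.Sum using (_⊎_; inj₁; inj₂; [_,_]′; map₂)
open import Data.Unit using (⊤)
open import Data.Vec using ([]; _∷_; _[_]≔_; here; there)
open import Function using (_∘_; id)
open import Level using (0ℓ)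
open import Relation.Binary.PropositionalEquality
  using (_≡_; _≢_; refl; cong; cong₂; subst; setoid) renaming (sym to ≡-sym; trans to ≡-trans)
open import Relation.Nullary using (¬_; yes; no; contradiction; ¬?; _×-dec_)
open import Relation.Nullary.Decidable using (decidable-stable)
open import Relation.Unary using (Pred; Decidable)

-- Permutations of lists and counting.

+-cong-head : ∀ {i j c} → i ≡ j → i + c ≡ j + c
+-cong-head {c = c} = cong (_+ c)

module _ {A : Set} where

  Unique-resp-↭ : {xs ys : List A} → xs ↭ ys → Unique xs → Unique ys
  Unique-resp-↭ = PermSetoid.Unique-resp-↭ (setoid A) ∘ ↭⇒↭ₛ

  Unique-++⁻ : ∀ (xs : List A) {ys} → Unique (xs ++ ys) → Unique xs × Unique ys × Disjoint xs ys
  Unique-++⁻ [] u = [] , u , λ ()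
  Unique-++⁻ (x ∷ xs) (x∉ ∷ u) with Unique-++⁻ xs u
  ... | uxs , uys , dis = All.++⁻ˡ xs x∉ ∷ uxs , uys , λ where
    (here refl , v∈ys) → All.lookup (All.++⁻ʳ xs x∉) v∈ys refl
    (there v∈xs , v∈ys) → dis (v∈xs , v∈ys)

  ∈⇒↭∷ : ∀ {v : A} {l} → v ∈ l → ∃ λ m → l ↭ v ∷ m
  ∈⇒↭∷ v∈l with ys , zs , refl ← ∈-∃++ v∈l = ys ++ zs , shift _ ys zs

  filter-++-↭ : ∀ {P : Pred A 0ℓ} (P? : Decidable P) l → filter P? l ++ filter (¬? ∘ P?) l ↭ l
  filter-++-↭ P? l = ↭-sym (subst (λ p → l ↭ proj₁ p ++ proj₂ p) (partition-defn P? l)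
    (↭ₛ⇒↭ (PermSetoid.partition-↭ (setoid A) P? l)))

  indicator : (A → Bool) → A → ℕ
  indicator f u = if f u then 1 else 0

  indicator-≡ : ∀ {f u b} → f u ≡ b → indicator f u ≡ (if b then 1 else 0)
  indicator-≡ = cong (λ b → if b then 1 else 0)

  -- Shaped so that `count (adj G v) (allFin n)` is `degree G v` by definition.
  count : (A → Bool) → List A → ℕ
  count f l = sum (map (indicator f) l)

  count-++ : ∀ f xs ys → count f (xs ++ ys) ≡ count f xs + count f ys
  count-++ f xs ys = ≡-trans (cong sum (map-++ (indicator f) xs ys)) (sum-++ (map (indicator f) xs) _)

  count-↭ : ∀ f {xs ys} → xs ↭ ys → count f xs ≡ count f ys
  count-↭ f p = sum-↭ (map⁺ (indicator f) p)

-- Walks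

module _ {V : Set} where

  data Walk (R : V → V → Set) : V → List V → V → Set where
    stop : ∀ {x} → Walk R x [ x ] x
    _∷_  : ∀ {x y z l} → R x y → Walk R y l z → Walk R x (x ∷ l) z

  infixr 5 _∷_

  module _ {R : V → V → Set} where

    start∈ : ∀ {x l y} → Walk R x l y → x ∈ l
    start∈ stop    = here refl
    start∈ (_ ∷ _) = here refl

    end∈ : ∀ {x l y} → Walk R x l y → y ∈ l
    end∈ stop    = here refl
    end∈ (_ ∷ w) = there (end∈ w)

    append : ∀ {x l y z m u} → Walk R x l y → R y z → Walk R z m u → Walk R x (l ++ m) u
    append stop    r w = r ∷ w
    append (s ∷ v) r w = s ∷ append v r w

    backwards : (∀ {u v} → R u v → R v u) → ∀ {x l y} → Walk R x l y → ∃ λ l′ → Walk R y l′ x × l′ ↭ l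
    backwards R-sym stop = _ , stop , ↭-refl
    backwards R-sym {x} {_ ∷ l} (r ∷ w) with l′ , w′ , l′↭l ← backwards R-sym w =
      l′ ++ [ x ] , append w′ (R-sym r) stop , ↭-trans (↭-sym (∷↭∷ʳ x l′)) (prep x l′↭l)

    mapWalk : ∀ {R′ : V → V → Set} → (∀ {u v} → R u v → R′ u v) → ∀ {x l y} → Walk R x l y → Walk R′ x l y
    mapWalk f stop    = stop
    mapWalk f (r ∷ w) = f r ∷ mapWalk f w

    closed-single : ∀ {x l} → Unique l → Walk R x l x → length l ≡ 1
    closed-single _ stop = refl
    closed-single u (_ ∷ w) = contradiction (end∈ w) (Unique[x∷xs]⇒x∉xs u)

    -- The shifted neighbourhood of rotation arguments: after such a vertex the walk can be cut so
    -- that the second piece starts at a vertex satisfying `f`. On a reversed walk it yields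
    -- successors.
    preds : (V → Bool) → ∀ {x l y} → Walk R x l y → List V
    preds f stop = []
    preds f (_∷_ {x} {y} _ w) = if f y then x ∷ preds f w else preds f w

    module _ (f : V → Bool) where

      -- Only the start has no predecessor on the walk, so it alone needs a separate term.
      count≡preds : ∀ {x l y} (w : Walk R x l y) → count f l ≡ indicator f x + length (preds f w)
      count≡preds stop = refl
      count≡preds (_∷_ {x} {y} _ w) with f y | count≡preds w
      ... | true  | eq = cong (indicator f x +_) eq
      ... | false | eq = cong (indicator f x +_) eq

      preds⊆ : ∀ {x l y v} (w : Walk R x l y) → v ∈ preds f w → v ∈ l
      preds⊆ (_∷_ {x} {y} _ w) v∈ with f y
      preds⊆ (_ ∷ w) (here refl) | true = here refl
      preds⊆ (_ ∷ w) (there v∈)  | true = there (preds⊆ w v∈)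
      preds⊆ (_ ∷ w) v∈          | false = there (preds⊆ w v∈)

      preds-unique : ∀ {x l y} (w : Walk R x l y) → Unique l → Unique (preds f w)
      preds-unique stop _ = []
      preds-unique (_∷_ {x} {y} _ w) (x∉ ∷ u) with f y
      ... | true  = All.tabulate (λ v∈ → All.lookup x∉ (preds⊆ w v∈)) ∷ preds-unique w u
      ... | false = preds-unique w u

      cut-preds : ∀ {x l y v} (w : Walk R x l y) → v ∈ preds f w →
        ∃ λ A → ∃ λ q → ∃ λ B → Walk R x A v × Walk R q B y × f q ≡ true × l ≡ A ++ B
      cut-preds (_∷_ {x} {y} r w) v∈ with f y in fy
      cut-preds (r ∷ w) (here refl) | true = _ , _ , _ , stop , w , fy , refl
      cut-preds (r ∷ w) (there v∈) | true
        with A , q , B , wA , wB , fq , refl ← cut-preds w v∈ = _ , q , B , r ∷ wA , wB , fq , refl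
      cut-preds (r ∷ w) v∈ | false
        with A , q , B , wA , wB , fq , refl ← cut-preds w v∈ = _ , q , B , r ∷ wA , wB , fq , refl

      end∉preds : ∀ {x l y} (w : Walk R x l y) → Unique l → y ∉ preds f w
      end∉preds w u y∈ with A , _ , _ , wA , wB , _ , refl ← cut-preds w y∈ =
        proj₂ (proj₂ (Unique-++⁻ A u)) (end∈ wA , end∈ wB)

      -- Scanning `l` from `z`, the cut falls just before the vertex numbered `j + 1` among those
      -- satisfying `f`. Keeping `x` apart from `l` makes the first piece nonempty even when that
      -- vertex is `z`.
      cut-at-count : ∀ j {x z l y} → R x z → Walk R z l y → j < count f l →
        ∃ λ A → ∃ λ p → ∃ λ q → ∃ λ B →
          Walk R x (x ∷ A) p × R p q × Walk R q B y × f q ≡ true × l ≡ A ++ B × count f A ≡ j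
      cut-at-count j {z = z} r w j< with f z in fz
      cut-at-count zero r w j< | true = [] , _ , _ , _ , stop , r , w , fz , refl , refl
      cut-at-count (suc j) r stop j< | true rewrite fz with s≤s () ← j<
      cut-at-count (suc j) {z = z} r (r′ ∷ w) j< | true
        with A , p , q , B , wA , s , wB , fq , refl , eq ← cut-at-count j r′ w
          (s≤s⁻¹ (subst (suc j <_) (+-cong-head (indicator-≡ {f = f} fz)) j<)) =
        z ∷ A , p , q , B , r ∷ wA , s , wB , fq , refl ,
        cong₂ _+_ (indicator-≡ {f = f} fz) eq
      cut-at-count j r stop j< | false rewrite fz with () ← j<
      cut-at-count j {z = z} r (r′ ∷ w) j< | false
        with A , p , q , B , wA , s , wB , fq , refl , eq ← cut-at-count j r′ w
          (subst (j <_) (+-cong-head (indicator-≡ {f = f} fz)) j<) =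
        z ∷ A , p , q , B , r ∷ wA , s , wB , fq , refl ,
        cong₂ _+_ (indicator-≡ {f = f} fz) eq

-- Bipartite holes

∈-insert⁻ : ∀ {n} (p : Subset n) v {u} → u Subset.∈ p [ v ]≔ inside → u ≡ v ⊎ u Subset.∈ p
∈-insert⁻ (_ ∷ p) zero    here = inj₁ refl
∈-insert⁻ (_ ∷ p) zero    (there u∈) = inj₂ (there u∈)
∈-insert⁻ (_ ∷ p) (suc v) here = inj₂ here
∈-insert⁻ (_ ∷ p) (suc v) (there u∈) with ∈-insert⁻ p v u∈
... | inj₁ eq = inj₁ (cong suc eq)
... | inj₂ u∈p = inj₂ (there u∈p)

∣insert∣ : ∀ {n} (p : Subset n) v → ¬ v Subset.∈ p → ∣ p [ v ]≔ inside ∣ ≡ suc ∣ p ∣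
∣insert∣ (inside  ∷ p) zero v∉ = contradiction here v∉
∣insert∣ (outside ∷ p) zero v∉ = refl
∣insert∣ (inside  ∷ p) (suc v) v∉ = cong suc (∣insert∣ p v (v∉ ∘ there))
∣insert∣ (outside ∷ p) (suc v) v∉ = ∣insert∣ p v (v∉ ∘ there)

fromUnique : ∀ {n} (l : List (Fin n)) → Unique l →
  ∃ λ (S : Subset n) → ∣ S ∣ ≡ length l × (∀ {v} → v Subset.∈ S → v ∈ l)
fromUnique {n} [] _ = Subset.⊥ , ∣⊥∣≡0 n , λ v∈ → contradiction v∈ ∉⊥
fromUnique (x ∷ l) (x∉l ∷ u) with S , ∣S∣ , S⊆l ← fromUnique l u =
  S [ x ]≔ inside ,
  ≡-trans (∣insert∣ S x (λ x∈S → All.lookup x∉l (S⊆l x∈S) refl)) (cong suc ∣S∣) ,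
  λ v∈ → conv (∈-insert⁻ S x v∈)
  where
  conv : ∀ {v} → v ≡ x ⊎ v Subset.∈ S → v ∈ x ∷ l
  conv (inj₁ v≡x) = here v≡x
  conv (inj₂ v∈S) = there (S⊆l v∈S)

subsetOfSize : ∀ {n} s (l : List (Fin n)) → Unique l → s ≤ length l →
  ∃ λ (S : Subset n) → ∣ S ∣ ≡ s × (∀ {v} → v Subset.∈ S → v ∈ l)
subsetOfSize s l u s≤ with S , ∣S∣ , S⊆ ← fromUnique (take s l) (take⁺ s u) =
  S , ≡-trans ∣S∣ (≡-trans (length-take s l) (m≤n⇒m⊓n≡m s≤)) ,
  λ v∈ → subst (_ ∈_) (take++drop≡id s l) (∈-++⁺ˡ (S⊆ v∈))

-- If a search finds no edge, the first `s` entries of `S` and the first `t` of `T` form a hole of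
-- the exact sizes excluded.
edge-between : ∀ {n} (G : Graph n) {s t} → ¬ HasBipartiteHole G s t →
  ∀ {S T} → Unique S → Unique T → Disjoint S T → s ≤ length S → t ≤ length T →
  ∃₂ λ u v → u ∈ S × v ∈ T × adj G u v ≡ true
edge-between G {s} {t} noHole {S} {T} uS uT dis s≤ t≤
  with Any.any? (λ u → Any.any? (λ v → adj G u v Bool.≟ true) T) S
... | yes found with u , u∈S , rest ← find found with v , v∈T , uv ← find rest =
  u , v , u∈S , v∈T , uv
... | no none
  with S′ , ∣S′∣ , S′⊆S ← subsetOfSize s S uS s≤
     | T′ , ∣T′∣ , T′⊆T ← subsetOfSize t T uT t≤ =
  contradiction
    (S′ , T′ , (λ x x∈S x∈T → dis (S′⊆S x∈S , T′⊆T x∈T)) , ∣S′∣ , ∣T′∣ ,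
     λ x y x∈S y∈T → Bool.¬-not (λ xy → none (lose (S′⊆S x∈S) (lose (T′⊆T y∈T) xy))))
    noHole

-- Rotations of Hamiltonian paths

module _ {n : ℕ} where

  -- Being a permutation of `allFin n` says at once that no vertex repeats and none is missed.
  HamPath : (Fin n → Fin n → Set) → Fin n → Fin n → Set
  HamPath R x y = ∃ λ l → Walk R x l y × l ↭ allFin n

  HamCycle : (Fin n → Fin n → Set) → Set
  HamCycle R = ∃₂ λ x y → HamPath R x y × R y x

  HamCycle-map : ∀ {R R′} → (∀ {u v} → R u v → R′ u v) → HamCycle R → HamCycle R′
  HamCycle-map f (x , y , (l , w , p) , yx) = x , y , (l , mapWalk f w , p) , f yx

  path-unique : ∀ {l} → l ↭ allFin n → Unique l
  path-unique p = Unique-resp-↭ (↭-sym p) (allFin⁺ n)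

  HamPath-sym : ∀ {R} → (∀ {u v} → R u v → R v u) → ∀ {x y} → HamPath R x y → HamPath R y x
  HamPath-sym R-sym (l , w , p) with l′ , w′ , p′ ← backwards R-sym w = l′ , w′ , ↭-trans p′ p

module Rotation {n : ℕ} (G : Graph n) {R : Fin n → Fin n → Set}
  (R-sym : ∀ {u v} → R u v → R v u) (G⊆R : ∀ {u v} → adj G u v ≡ true → R u v) where

  G-sym : ∀ {u v} → adj G u v ≡ true → R v u
  G-sym = R-sym ∘ G⊆R

  -- The path x ⋯ u q ⋯ b v ⋯ y with chords xq, yb and uv.
  parallel-chords : ∀ {x y u q b v A B C} → A ++ B ++ C ↭ allFin n →
    Walk R x A u → Walk R q B b → Walk R v C y →
    adj G x q ≡ true → adj G y b ≡ true → adj G u v ≡ true → HamCycle R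
  parallel-chords {A = A} {B} {C} p wA wB wC xq yb uv with B′ , wB′ , B′↭B ← backwards R-sym wB =
    _ , _ , (_ , append wA (G⊆R uv) (append wC (G⊆R yb) wB′) ,
      ↭-trans (++⁺ˡ A (↭-trans (++⁺ˡ C B′↭B) (++-comm C B))) p) , G-sym xq

  -- The path x ⋯ u b ⋯ v q ⋯ y with chords xq, yb and uv.
  crossing-chords : ∀ {x y u b v q A B C} → A ++ B ++ C ↭ allFin n →
    Walk R x A u → Walk R b B v → Walk R q C y →
    adj G x q ≡ true → adj G y b ≡ true → adj G u v ≡ true → HamCycle R
  crossing-chords {A = A} {B} {C} p wA wB wC xq yb uv with A′ , wA′ , A′↭A ← backwards R-sym wA =
    _ , _ , (_ , append wA′ (G⊆R xq) (append wC (G⊆R yb) wB) ,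
      ↭-trans (++⁺ A′↭A (++-comm C B)) p) , G-sym uv

  -- With `s = suc m`, the equation `s + t = k + 1` reads `k = m + t`, so both ends are assumed
  -- high.
  module _ {m t : ℕ} (noHole : ¬ HasBipartiteHole G (suc m) t)
    {x y : Fin n} (dx : m + t ≤ degree G x) (dy : m + t ≤ degree G y) (1≤t : 1 ≤ t) where

    f g : Fin n → Bool
    f = adj G x
    g = adj G y

    indicator-self : ∀ v → indicator (adj G v) v ≡ 0
    indicator-self v rewrite irrefl G v = refl

    module _ (xy : adj G x y ≡ false) {A p q B} (wA : Walk R x A p) (pq : R p q) (wB : Walk R q B y)
      (fq : f q ≡ true) (span : A ++ B ↭ allFin n) (countA : count f A ≡ m) where

      uAB : Unique A × Unique B × Disjoint A B
      uAB = Unique-++⁻ A (path-unique span)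
      uA = proj₁ uAB
      uB = proj₁ (proj₂ uAB)
      A#B = proj₂ (proj₂ uAB)

      p∷-unique : ∀ h → Unique (p ∷ preds h wA)
      p∷-unique h = All.tabulate (λ { v∈ refl → end∉preds h wA uA v∈ }) ∷ preds-unique h wA uA

      -- Since `p` precedes `q`, the list `p ∷ preds f wA` holds the predecessors of the first
      -- `suc m` neighbours of `x`. On the reversed `B`, `preds` gives successors in path order; `y`
      -- comes first there and is not its own neighbour, so none is lost.
      rotate-late : t ≤ count g B → HamCycle R
      rotate-late t≤ with B′ , wB′ , B′↭B ← backwards R-sym wB
        with edge-between G noHole (p∷-unique f)
               (preds-unique g wB′ (Unique-resp-↭ (↭-sym B′↭B) uB))
               (λ where
                 (here refl , v∈) → A#B (end∈ wA , ∈-resp-↭ B′↭B (preds⊆ g wB′ v∈))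
                 (there u∈ , v∈) → A#B (preds⊆ f wA u∈ , ∈-resp-↭ B′↭B (preds⊆ g wB′ v∈)))
               (s≤s (≤-reflexive (≡-trans (≡-sym countA)
                 (≡-trans (count≡preds f wA) (+-cong-head (indicator-self x))))))
               (subst (t ≤_) (≡-trans (≡-sym (count-↭ g B′↭B))
                 (≡-trans (count≡preds g wB′) (+-cong-head (indicator-self y)))) t≤)
      ... | u , v , u∈ , v∈ , uv with C′ , b , B₁′ , wC′ , wB₁′ , gb , refl ← cut-preds g wB′ v∈
        -- Turned back into path order, `B` reads `q ⋯ b v ⋯ y`.
        with C , wC , C↭ ← backwards R-sym wC′ | B₁ , wB₁ , B₁↭ ← backwards R-sym wB₁′
        with u∈ | ↭-trans (↭-sym B′↭B) (↭-trans (++-comm C′ B₁′) (++⁺ (↭-sym B₁↭) (↭-sym C↭)))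
      ... | here refl | B↭ = parallel-chords (↭-trans (++⁺ˡ A (↭-sym B↭)) span) wA wB₁ wC fq gb uv
      ... | there u∈′ | B↭ with A₁ , q′ , A₂ , wA₁ , wA₂ , fq′ , refl ← cut-preds f wA u∈′ =
        -- The middle piece runs from `q′` through the step `pq` to `b`.
        parallel-chords
          (↭-trans (↭-trans (++⁺ˡ A₁ (↭-trans (++-assoc A₂ B₁ C) (++⁺ˡ A₂ (↭-sym B↭))))
                             (↭-sym (++-assoc A₁ A₂ B))) span)
          wA₁ (append wA₂ pq wB₁) wC fq′ gb uv

      -- Both sets now consist of predecessors. As `x` and `y` are not adjacent, every neighbour of
      -- `y` in `A` has its predecessor in `A`. The predecessor `p` of `q` is not among these,
      -- because it is the last vertex of `A`.
      rotate-early : suc m ≤ count g A → t ≤ count f B → HamCycle R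
      rotate-early m< t≤
        with edge-between G noHole (preds-unique g wA uA)
               (All.tabulate (λ { v∈ refl → A#B (end∈ wA , preds⊆ f wB v∈) }) ∷ preds-unique f wB uB)
               (λ where
                 (u∈ , here refl) → end∉preds g wA uA u∈
                 (u∈ , there v∈) → A#B (preds⊆ g wA u∈ , preds⊆ f wB v∈))
               (subst (suc m ≤_) (≡-trans (count≡preds g wA)
                 (+-cong-head (indicator-≡ {f = g} (≡-trans (sym G y x) xy)))) m<)
               (subst (t ≤_) (≡-trans (count≡preds f wB) (+-cong-head (indicator-≡ {f = f} fq))) t≤)
      ... | u , v , u∈ , v∈ , uv with A₁ , b , A₂ , wA₁ , wA₂ , gb , refl ← cut-preds g wA u∈
        with v∈
      ... | here refl = crossing-chords (↭-trans (↭-sym (++-assoc A₁ A₂ B)) span) wA₁ wA₂ wB fq gb uv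
      ... | there v∈′ with B₁ , q′ , B₂ , wB₁ , wB₂ , fq′ , refl ← cut-preds f wB v∈′ =
        crossing-chords
          (↭-trans (↭-trans (++⁺ˡ A₁ (++-assoc A₂ B₁ B₂)) (↭-sym (++-assoc A₁ A₂ (B₁ ++ B₂)))) span)
          wA₁ (append wA₂ pq wB₁) wB₂ fq′ gb uv

      split-degree : ∀ h → m + t ≤ count h (allFin n) → m + t ≤ count h A + count h B
      split-degree h = subst (m + t ≤_) (≡-trans (≡-sym (count-↭ h span)) (count-++ h A B))

      -- Both degrees are at least `m + t`. As `A` has exactly `m` neighbours of `x`, at least `t`
      -- are in `B`; and if `A` has at most `m` neighbours of `y`, at least `t` of those are in `B`.
      rotate-cut : HamCycle R
      rotate-cut with suc m ≤? count g A
      ... | yes m< = rotate-early m< (+-cancelˡ-≤ m t _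
              (subst (λ c → m + t ≤ c + count f B) countA (split-degree f dx)))
      ... | no m≮ = rotate-late (+-cancelˡ-≤ m t _
              (≤-trans (split-degree g dy) (+-monoˡ-≤ (count g B) (s≤s⁻¹ (≰⇒> m≮)))))

    rotate : HamPath R x y → HamCycle R
    rotate path with adj G x y in xy
    ... | true = _ , _ , path , G-sym xy
    -- On a single vertex `x` has degree 0, against `1 ≤ t`.
    rotate (_ , stop , p) | false =
      contradiction (≤-trans 1≤t (≤-trans (m≤n+m t m) dx))
        (≤⇒≯ (≤-reflexive (≡-trans (≡-sym (count-↭ f p)) (cong (_+ 0) (indicator-self x)))))
    rotate (_ , r ∷ w , p) | false
      -- By `1 ≤ t` the degree of `x` exceeds `m`, and `x` adds nothing to its own count, so the cut
      -- comes before neighbour number `m + 1`, that is `s`.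
      with A , _ , _ , B , wA , pq , wB , fq , refl , eq ← cut-at-count f m r w
        (≤-trans (≤-trans (≤-reflexive (+-comm 1 m)) (≤-trans (+-monoʳ-≤ m 1≤t) dx))
          (≤-reflexive (≡-trans (≡-sym (count-↭ f p)) (+-cong-head (indicator-self x))))) =
      rotate-cut xy wA pq wB fq p (≡-trans (+-cong-head (indicator-self x)) eq)

length-allFin : ∀ {n} {l : List (Fin n)} → l ↭ allFin n → length l ≡ n
length-allFin {n} p = ≡-trans (↭-length p) (length-tabulate {n = n} (λ i → i))

-- Removing edges between high vertices

module _ {n : ℕ} (3≤n : 3 ≤ n) {R R⁺ : Fin n → Fin n → Set}
  (R⁺-sym : ∀ {u v} → R⁺ u v → R⁺ v u) {x y : Fin n} where

  Joins : Fin n → Fin n → Set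
  Joins u v = (u ≡ x × v ≡ y) ⊎ (u ≡ y × v ≡ x)

  module _ (R⁺⇒ : ∀ {u v} → R⁺ u v → R u v ⊎ Joins u v) where

    first-new-edge : ∀ {u l v} → Walk R⁺ u l v → Walk R u l v ⊎
      ∃ λ A → ∃ λ p → ∃ λ q → ∃ λ B → Walk R⁺ u A p × Joins p q × Walk R⁺ q B v × l ≡ A ++ B
    first-new-edge stop = inj₁ stop
    first-new-edge (r ∷ w) with R⁺⇒ r
    ... | inj₂ new = inj₂ (_ , _ , _ , _ , stop , new , w , refl)
    ... | inj₁ old with first-new-edge w
    ...   | inj₁ w′ = inj₁ (old ∷ w′)
    ...   | inj₂ (A , p , q , B , wA , new , wB , refl) = inj₂ (_ , p , q , B , r ∷ wA , new , wB , refl)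

    avoids : ∀ {u l v} → All (x ≢_) l → Walk R⁺ u l v → Walk R u l v
    avoids _ stop = stop
    avoids (x≢u ∷ x∉) (r ∷ w) with R⁺⇒ r
    ... | inj₁ old = old ∷ avoids x∉ w
    ... | inj₂ (inj₁ (refl , _)) = contradiction refl x≢u
    ... | inj₂ (inj₂ (_ , refl)) = contradiction refl (All.lookup x∉ (start∈ w))

    -- Every new edge meets `x`, so only the first step can be new. It would lead straight to the
    -- end `y`, leaving a path of two vertices, against `3 ≤ n`.
    path-between-ends : HamPath R⁺ x y → HamPath R x y
    path-between-ends (l , w , p) = l , go w (path-unique p) (subst (3 ≤_) (≡-sym (length-allFin p)) 3≤n) , p
      where
      go : ∀ {l} → Walk R⁺ x l y → Unique l → 3 ≤ length l → Walk R x l y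
      go stop _ (s≤s ())
      go (r ∷ w) (x∉ ∷ u) 3≤ with R⁺⇒ r
      ... | inj₁ old = old ∷ avoids x∉ w
      ... | inj₂ (inj₁ (_ , refl)) rewrite closed-single u w with s≤s (s≤s ()) ← 3≤
      go (r ∷ w) (x∉ ∷ u) 3≤ | inj₂ (inj₂ (_ , refl)) = contradiction refl (All.lookup x∉ (start∈ w))

    path-between-joined : ∀ {u v} → HamPath R⁺ u v → Joins u v → HamPath R x y
    path-between-joined path (inj₁ (refl , refl)) = path-between-ends path
    path-between-joined path (inj₂ (refl , refl)) = path-between-ends (HamPath-sym R⁺-sym path)

    remove-edge : HamCycle R⁺ → HamCycle R ⊎ HamPath R x y
    remove-edge (u , v , (l , w , p) , vu) with first-new-edge w
    ... | inj₂ (A , a , b , B , wA , new , wB , refl) =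
      -- Opening the cycle at the new edge leaves the path `B`, closing edge `vu`, `A`.
      inj₂ (path-between-joined (_ , append wB vu wA , ↭-trans (++-comm B A) p) (swapped new))
      where
      swapped : ∀ {u v} → Joins u v → Joins v u
      swapped (inj₁ (e , e′)) = inj₂ (e′ , e)
      swapped (inj₂ (e , e′)) = inj₁ (e′ , e)
    ... | inj₁ w′ with R⁺⇒ vu
    ...   | inj₁ old = inj₁ (u , v , (l , w′ , p) , old)
    ...   | inj₂ (inj₁ (e , e′)) = inj₂ (path-between-joined (l , w , p) (inj₂ (e′ , e)))
    ...   | inj₂ (inj₂ (e , e′)) = inj₂ (path-between-joined (l , w , p) (inj₁ (e′ , e)))

module Closure {n : ℕ} (G : Graph n) (3≤n : 3 ≤ n) {m t : ℕ} (1≤t : 1 ≤ t)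
  (noHole : ¬ HasBipartiteHole G (suc m) t) where

  High : Fin n → Set
  High v = m + t ≤ degree G v

  -- Highness is demanded by the relation, not of the listed pairs, so `ps` may start as all pairs;
  -- a pair with a low member adds no edge.
  Extended : List (Fin n × Fin n) → Fin n → Fin n → Set
  Extended ps u v = adj G u v ≡ true ⊎ (High u × High v × ((u , v) ∈ ps ⊎ (v , u) ∈ ps))

  Extended-sym : ∀ {ps u v} → Extended ps u v → Extended ps v u
  Extended-sym {u = u} {v} (inj₁ uv) = inj₁ (≡-trans (sym G v u) uv)
  Extended-sym (inj₂ (hu , hv , inj₁ e)) = inj₂ (hv , hu , inj₂ e)
  Extended-sym (inj₂ (hu , hv , inj₂ e)) = inj₂ (hv , hu , inj₁ e)

  Extended-∷ : ∀ {x y ps u v} → Extended ((x , y) ∷ ps) u v →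
    Extended ps u v ⊎ (High x × High y × ((u ≡ x × v ≡ y) ⊎ (u ≡ y × v ≡ x)))
  Extended-∷ (inj₁ uv) = inj₁ (inj₁ uv)
  Extended-∷ (inj₂ (hu , hv , inj₁ (here refl))) = inj₂ (hu , hv , inj₁ (refl , refl))
  Extended-∷ (inj₂ (hu , hv , inj₂ (here refl))) = inj₂ (hv , hu , inj₂ (refl , refl))
  Extended-∷ (inj₂ (hu , hv , inj₁ (there e))) = inj₁ (inj₂ (hu , hv , inj₁ e))
  Extended-∷ (inj₂ (hu , hv , inj₂ (there e))) = inj₁ (inj₂ (hu , hv , inj₂ e))

  contract : ∀ ps → HamCycle (Extended ps) → HamCycle (Extended [])
  contract [] c = c
  contract ((x , y) ∷ ps) c with (m + t ≤? degree G x) ×-dec (m + t ≤? degree G y)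
  ... | no ¬high = contract ps
    (HamCycle-map ([ id , (λ (hx , hy , _) → contradiction (hx , hy) ¬high) ]′ ∘ Extended-∷) c)
  ... | yes (hx , hy) with remove-edge 3≤n (Extended-sym {(x , y) ∷ ps}) (map₂ (proj₂ ∘ proj₂) ∘ Extended-∷) c
  ...   | inj₁ c′ = contract ps c′
  ...   | inj₂ path = contract ps (Rotation.rotate G (Extended-sym {ps}) inj₁ noHole hx hy 1≤t path)

-- Covering by two cliques

module _ {V : Set} {R : V → V → Set} {Q : V → Set}
  (clique : ∀ {u v} → Q u → Q v → u ≢ v → R u v) where

  clique-walk : ∀ a ms b → Unique (a ∷ ms ++ [ b ]) → All Q (a ∷ ms ++ [ b ]) → Walk R a (a ∷ ms ++ [ b ]) b
  clique-walk a [] b ((a≢b ∷ _) ∷ _) (qa ∷ qb ∷ _) = clique qa qb a≢b ∷ stop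
  clique-walk a (m ∷ ms) b ((a≢m ∷ _) ∷ u) (qa ∷ qs@(qm ∷ _)) =
    clique qa qm a≢m ∷ clique-walk m ms b u qs

  -- With `a` moved to the front and `b` to the back, any order of the other vertices is a walk in a
  -- clique.
  clique-path : ∀ {a b l} → Unique l → All Q l → a ∈ l → b ∈ l →
    a ≢ b ⊎ (a ≡ b × (∀ v → Q v → v ≡ a)) → ∃ λ l′ → Walk R a l′ b × l′ ↭ l
  clique-path {a} {b} u qs a∈ b∈ (inj₁ a≢b) with l₁ , l↭ ← ∈⇒↭∷ a∈ with ∈-resp-↭ l↭ b∈
  ... | here b≡a = contradiction (≡-sym b≡a) a≢b
  ... | there b∈l₁ with l₂ , l₁↭ ← ∈⇒↭∷ b∈l₁ =
    _ , clique-walk a l₂ b (Unique-resp-↭ p u) (All-resp-↭ p qs) , ↭-sym p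
    where p = ↭-trans l↭ (prep a (↭-trans l₁↭ (∷↭∷ʳ b l₂)))
  clique-path {a} u qs a∈ _ (inj₂ (refl , only)) with ∈⇒↭∷ a∈
  ... | [] , l↭ = _ , stop , ↭-sym l↭
  ... | v ∷ _ , l↭ with (a≢v ∷ _) ∷ _ ← Unique-resp-↭ l↭ u | _ ∷ qv ∷ _ ← All-resp-↭ l↭ qs =
    contradiction (≡-sym (only _ qv)) a≢v

clique-cycle : ∀ {n} {R : Fin n → Fin n → Set} → 3 ≤ n → (∀ {u v} → u ≢ v → R u v) → HamCycle R
clique-cycle {n} (s≤s (s≤s (s≤s _))) complete =
  zero , suc zero ,
  clique-path {Q = λ _ → ⊤} (λ _ _ → complete) (allFin⁺ n) (All.tabulate _) (∈-allFin _) (∈-allFin _) (inj₁ (λ ())) ,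
  complete (λ ())

-- Crossing edges and the cycle through both cliques.

third-vertex : ∀ {n} → 3 ≤ n → (a b : Fin n) → ∃ λ c → c ≢ a × c ≢ b
third-vertex (s≤s (s≤s (s≤s _))) zero          zero          = suc zero , (λ ()) , λ ()
third-vertex (s≤s (s≤s (s≤s _))) zero          (suc zero)    = suc (suc zero) , (λ ()) , λ ()
third-vertex (s≤s (s≤s (s≤s _))) zero          (suc (suc _)) = suc zero , (λ ()) , λ ()
third-vertex (s≤s (s≤s (s≤s _))) (suc zero)    zero          = suc (suc zero) , (λ ()) , λ ()
third-vertex (s≤s (s≤s (s≤s _))) (suc (suc _)) zero          = suc zero , (λ ()) , λ ()
third-vertex (s≤s (s≤s (s≤s _))) (suc _)       (suc _)       = zero , (λ ()) , λ ()

another : ∀ {n} {Q : Fin n → Set} → Decidable Q → ∀ a →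
  (∃ λ v → Q v × v ≢ a) ⊎ (∀ v → Q v → v ≡ a)
another Q? a with any? (λ v → Q? v ×-dec ¬? (v ≟ a))
... | yes found = inj₁ found
... | no none = inj₂ λ v qv → decidable-stable (v ≟ a) (λ v≢a → none (v , qv , v≢a))

module _ {n : ℕ} (G : Graph n) {P : Fin n → Set} (P? : Decidable P) where

  -- The walk steps out of `P` somewhere. Carrying `ok` along ensures that on a walk avoiding a
  -- vertex the edge found avoids it too.
  crossing-edge : ∀ {ok : Fin n → Set} {x y} → Reach G ok x y → P x → ¬ P y →
    ∃₂ λ u v → ok u × ok v × P u × ¬ P v × adj G u v ≡ true
  crossing-edge (here _) px ¬px = contradiction px ¬px
  crossing-edge (step {x} {z} okx xz w) px ¬py with P? z
  ... | yes pz = crossing-edge w pz ¬py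
  ... | no ¬pz = x , z , okx , start w , px , ¬pz , xz
    where
    start : ∀ {ok : Fin n → Set} {x y} → Reach G ok x y → ok x
    start (here o) = o
    start (step o _ _) = o

  -- Meant for the ends of two crossing edges on one side: they differ, unless the side is a single
  -- vertex, which a one-vertex walk covers.
  Spread : (Fin n → Set) → Fin n → Fin n → Set
  Spread Q a b = a ≢ b ⊎ (a ≡ b × (∀ v → Q v → v ≡ a))

  Spread-sym : ∀ {Q : Fin n → Set} {a b} → Spread Q a b → Spread Q b a
  Spread-sym (inj₁ a≢b) = inj₁ (a≢b ∘ ≡-sym)
  Spread-sym (inj₂ (refl , only)) = inj₂ (refl , only)

  -- Connectedness gives one crossing edge `ab`. Where a side has a further vertex, deleting its end
  -- of `ab` gives a crossing edge with another end on that side; a suitable pair is then chosen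
  -- among these edges.
  two-crossing-edges : TwoConnected G → ∃ P → ∃ (¬_ ∘ P) →
    ∃₂ λ a b → ∃₂ λ a′ b′ → P a × P a′ × ¬ P b × ¬ P b′ ×
      adj G a b ≡ true × adj G a′ b′ ≡ true × Spread P a a′ × Spread (¬_ ∘ P) b b′
  two-crossing-edges (3≤n , connected , robust) (x , px) (y , ¬py)
    with a , b , _ , _ , pa , ¬pb , ab ← crossing-edge (connected x y) px ¬py =
    second (another P? a) (another (¬? ∘ P?) b)
    where
    a≢b : a ≢ b
    a≢b refl = ¬pb pa

    second : (∃ λ v → P v × v ≢ a) ⊎ (∀ v → P v → v ≡ a) →
      (∃ λ v → ¬ P v × v ≢ b) ⊎ (∀ v → ¬ P v → v ≡ b) → _
    -- Two one-vertex sides would leave no room for a third vertex.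
    second (inj₂ onlyA) (inj₂ onlyB) with c , c≢a , c≢b ← third-vertex 3≤n a b with P? c
    ... | yes pc = contradiction (onlyA _ pc) c≢a
    ... | no ¬pc = contradiction (onlyB _ ¬pc) c≢b
    second (inj₁ (a⁺ , pa⁺ , a⁺≢a)) (inj₂ onlyB)
      with a′ , b′ , a′≢a , _ , pa′ , ¬pb′ , ab′ ← crossing-edge (robust a a⁺ b a⁺≢a (a≢b ∘ ≡-sym)) pa⁺ ¬pb =
      a , b , a′ , b′ , pa , pa′ , ¬pb , ¬pb′ , ab , ab′ ,
      inj₁ (a′≢a ∘ ≡-sym) , inj₂ (≡-sym (onlyB _ ¬pb′) , onlyB)
    second (inj₂ onlyA) (inj₁ (b⁺ , ¬pb⁺ , b⁺≢b))
      with a′ , b′ , _ , b′≢b , pa′ , ¬pb′ , ab′ ← crossing-edge (robust b a b⁺ a≢b b⁺≢b) pa ¬pb⁺ =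
      a , b , a′ , b′ , pa , pa′ , ¬pb , ¬pb′ , ab , ab′ ,
      inj₂ (≡-sym (onlyA _ pa′) , onlyA) , inj₁ (b′≢b ∘ ≡-sym)
    second (inj₁ (a⁺ , pa⁺ , a⁺≢a)) (inj₁ (b⁺ , ¬pb⁺ , b⁺≢b))
      with a₁ , b₁ , a₁≢a , _ , pa₁ , ¬pb₁ , ab₁ ← crossing-edge (robust a a⁺ b a⁺≢a (a≢b ∘ ≡-sym)) pa⁺ ¬pb
      with a₂ , b₂ , _ , b₂≢b , pa₂ , ¬pb₂ , ab₂ ← crossing-edge (robust b a b⁺ a≢b b⁺≢b) pa ¬pb⁺
      with b₁ ≟ b | a₂ ≟ a
    ... | no b₁≢b | _ =
      a , b , a₁ , b₁ , pa , pa₁ , ¬pb , ¬pb₁ , ab , ab₁ , inj₁ (a₁≢a ∘ ≡-sym) , inj₁ (b₁≢b ∘ ≡-sym)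
    ... | yes _ | no a₂≢a =
      a , b , a₂ , b₂ , pa , pa₂ , ¬pb , ¬pb₂ , ab , ab₂ , inj₁ (a₂≢a ∘ ≡-sym) , inj₁ (b₂≢b ∘ ≡-sym)
    -- Each new edge shares an end with `ab`, but on opposite sides, so the two new edges are
    -- disjoint.
    ... | yes refl | yes refl =
      a₁ , b₁ , a₂ , b₂ , pa₁ , pa₂ , ¬pb₁ , ¬pb₂ , ab₁ , ab₂ , inj₁ a₁≢a , inj₁ (b₂≢b ∘ ≡-sym)

  two-clique-cycle : TwoConnected G → {R : Fin n → Fin n → Set} →
    (∀ {u v} → adj G u v ≡ true → R u v) →
    (∀ {u v} → P u → P v → u ≢ v → R u v) → (∀ {u v} → ¬ P u → ¬ P v → u ≢ v → R u v) → HamCycle R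
  two-clique-cycle 2conn G⊆R cliqueP clique¬P with any? P? | any? (¬? ∘ P?)
  -- If one side is empty, the whole vertex set is a single clique.
  ... | no noP | _ = clique-cycle (proj₁ 2conn) (clique¬P (λ pu → noP (_ , pu)) (λ pv → noP (_ , pv)))
  ... | _ | no no¬P = clique-cycle (proj₁ 2conn) (cliqueP (all _) (all _))
    where
    all : ∀ v → P v
    all v = decidable-stable (P? v) (λ ¬pv → no¬P (v , ¬pv))
  ... | yes someP | yes some¬P
    with a , b , a′ , b′ , pa , pa′ , ¬pb , ¬pb′ , ab , ab′ , spreadP , spread¬P
      ← two-crossing-edges 2conn someP some¬P
    with A , wA , A↭ ← clique-path cliqueP (filter⁺ P? (allFin⁺ n)) (All.all-filter P? (allFin n))
                         (∈-filter⁺ P? (∈-allFin a) pa) (∈-filter⁺ P? (∈-allFin a′) pa′) spreadP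
       | B , wB , B↭ ← clique-path clique¬P (filter⁺ (¬? ∘ P?) (allFin⁺ n)) (All.all-filter (¬? ∘ P?) (allFin n))
                         (∈-filter⁺ (¬? ∘ P?) (∈-allFin b′) ¬pb′) (∈-filter⁺ (¬? ∘ P?) (∈-allFin b) ¬pb)
                         (Spread-sym spread¬P) =
    -- The cycle is `a ⋯ a′` inside `P`, then `b′ ⋯ b` outside, closed by `ba`.
    a , b , (A ++ B , append wA (G⊆R ab′) wB , ↭-trans (++⁺ A↭ B↭) (filter-++-↭ P? (allFin n))) ,
    G⊆R (≡-trans (sym G b a) ab)

-- Translation to `Hamiltonian` and conclusion.

Walk⇒Closes : ∀ {n} (G : Graph n) {x y z l} → Walk (λ u v → adj G u v ≡ true) x l y → adj G y z ≡ true →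
  ∃ λ vs → l ≡ x ∷ vs × Closes G z x vs
Walk⇒Closes G stop yz = [] , refl , yz
Walk⇒Closes G (r ∷ w) yz with vs , refl , closed ← Walk⇒Closes G w yz = _ , refl , r , closed

HamCycle⇒Hamiltonian : ∀ {n} (G : Graph n) → 3 ≤ n → HamCycle (λ u v → adj G u v ≡ true) → Hamiltonian G
HamCycle⇒Hamiltonian G 3≤n (x , y , (l , w , p) , yx) with vs , refl , closed ← Walk⇒Closes G w yx =
  x , vs , path-unique p , (λ v → ∈-resp-↭ (↭-sym p) (∈-allFin v)) ,
  s≤s⁻¹ (subst (3 ≤_) (≡-sym (length-allFin p)) 3≤n) , closed

-- Each degree is at most `k - 1`, so the sum falls one short of the bound on `σ₂`; this forces
-- distinct low vertices to be adjacent.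
low-degree-sum : ∀ {k a b} → a < k → b < k → a + b < 2 * k ∸ 1
low-degree-sum {suc k} {a} {b} (s≤s a≤k) (s≤s b≤k) =
  ≤-trans (s≤s (+-mono-≤ a≤k b≤k))
    (≤-reflexive (≡-trans (≡-sym (+-suc k k)) (cong (λ c → k + suc c) (≡-sym (+-identityʳ k)))))

theorem1p4 : ∀ {n : ℕ} (G : Graph n) (k : ℕ) → TwoConnected G → IsBipartiteHoleNumber G k → σ₂≥ G (2 * k ∸ 1) → Hamiltonian G
theorem1p4 {n} G k 2conn@(3≤n , _) ((suc m , t , _ , 1≤t , s+t≡1+k , noHole) , _) σ₂
  -- As `s` is `suc m`, this replaces `k` by `m + t`, the threshold in `High`.
  with refl ← suc-injective s+t≡1+k =
  HamCycle⇒Hamiltonian G 3≤n (HamCycle-map old (contract allPairs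
    (two-clique-cycle G (λ v → m + t ≤? degree G v) 2conn inj₁
      (λ hu hv _ → inj₂ (hu , hv , inj₁ (∈-cartesianProduct⁺ (∈-allFin _) (∈-allFin _))))
      (λ lu lv u≢v → inj₁ (low-clique lu lv u≢v)))))
  where
  open Closure G 3≤n 1≤t noHole

  allPairs : List (Fin n × Fin n)
  allPairs = cartesianProduct (allFin n) (allFin n)

  low-clique : ∀ {u v} → ¬ High u → ¬ High v → u ≢ v → adj G u v ≡ true
  low-clique {u} {v} lu lv u≢v with adj G u v in uv
  ... | true  = refl
  ... | false = contradiction (σ₂ u v u≢v uv) (<⇒≱ (low-degree-sum (≰⇒> lu) (≰⇒> lv)))

  old : ∀ {u v} → Extended [] u v → adj G u v ≡ true
  old (inj₁ uv) = uv
  old (inj₂ (_ , _ , inj₁ ()))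
  old (inj₂ (_ , _ , inj₂ ()))
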